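{- Let $G_{18}$ be the graph on the $18$ vertices $x_i,a_i,b_i,c_i,d_i,e_i,f_i,g_i,h_i$ ($i=1,2$) with edge set $$\bigcup_{i=1}^{2}\{x_ia_i,\ x_ib_i,\ a_ic_i,\ b_id_i,\ c_id_i,\ c_ie_i,\ d_if_i,\ e_ig_i,\ e_ih_i,\ f_ig_i,\ f_ih_i\}\cup\{x_1x_2\}.$$ Then $G_{18}$ is connected, subcubic (maximum degree at most $3$), has no $K_4$ minor, and has no crumby coloring.
   Context: A red-blue coloring of the vertices of a graph is called crumby if (1) the subgraph induced by the blue vertices has maximum degree at most $1$, (2) every red vertex has at least one red neighbour, and (3) the subgraph induced by the red vertices contains no path on four vertices as a subgraph (not necessarily induced), i.e., there are no four distinct red vertices $v_1,v_2,v_3,v_4$ with $v_1v_2,v_2v_3,v_3v_4$ edges. -}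

module Defs where

open import Level using (0ℓ)
open import Data.Nat using (ℕ; _≤_; _*_; _+_)
open import Data.Fin using (Fin; zero; suc; #_)
open import Data.Fin.Properties using () renaming (_≟_ to _≟ᶠ_)
open import Data.Bool using (Bool; true; false)
open import Data.List using (List; []; _∷_; _++_; length; filter; allFin)
open import Data.List.Membership.Propositional using (_∈_)
open import Data.List.Membership.DecPropositional using () renaming (_∈?_ to mem?)
open import Data.Product using (Σ; ∃; _×_; _,_)
open import Data.Product.Properties using (≡-dec)
open import Data.Sum using (_⊎_)
open import Data.Empty using (⊥)
open import Data.Unit using (⊤)
open import Relation.Nullary using (¬_; Dec)
open import Relation.Nullary.Decidable using (_⊎-dec_)
open import Relation.Binary.PropositionalEquality using (_≡_; _≢_)

module _ {V : Set} (E : V → V → Set) where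

  data WalkIn (S : V → Set) : V → V → Set where
    here : ∀ {u} → S u → WalkIn S u u
    step : ∀ {u v w} → S u → E u v → WalkIn S v w → WalkIn S u w

  ConnectedIn : (V → Set) → Set
  ConnectedIn S = ∀ u v → S u → S v → WalkIn S u v

  Connected : Set
  Connected = ∀ u v → WalkIn (λ _ → ⊤) u v

  HasK4Minor : Set₁
  HasK4Minor =
    Σ (Fin 4 → V → Set) λ B →
      (∀ i → ∃ λ v → B i v) ×
      (∀ i j v → i ≢ j → B i v → B j v → ⊥) ×
      (∀ i → ConnectedIn (B i)) ×
      (∀ i j → i ≢ j → ∃ λ u → ∃ λ v → B i u × B j v × E u v)

  Red Blue : (V → Bool) → V → Set
  Red  c v = c v ≡ true
  Blue c v = c v ≡ false

  IsCrumby : (V → Bool) → Set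
  IsCrumby c =
    (∀ v u w → Blue c v → Blue c u → Blue c w → E v u → E v w → u ≡ w) ×
    (∀ v → Red c v → ∃ λ u → E v u × Red c u) ×
    (∀ v₁ v₂ v₃ v₄ → Red c v₁ → Red c v₂ → Red c v₃ → Red c v₄ →
       v₁ ≢ v₂ → v₁ ≢ v₃ → v₁ ≢ v₄ → v₂ ≢ v₃ → v₂ ≢ v₄ → v₃ ≢ v₄ →
       E v₁ v₂ → E v₂ v₃ → E v₃ v₄ → ⊥)

  HasCrumbyColouring : Set
  HasCrumbyColouring = ∃ λ (c : V → Bool) → IsCrumby c

degree : ∀ {n} {E : Fin n → Fin n → Set} → (∀ u v → Dec (E u v)) → Fin n → ℕ
degree {n} E? u = length (filter (E? u) (allFin n))

Subcubic : ∀ {n} {E : Fin n → Fin n → Set} → (∀ u v → Dec (E u v)) → Set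
Subcubic {n} E? = ∀ u → degree E? u ≤ 3

data Letter : Set where
  x a b c d e f g h : Letter


V18 : Set
V18 = Fin 18

v₁ v₂ : Letter → V18
v₁ x = # 0
v₁ a = # 1
v₁ b = # 2
v₁ c = # 3
v₁ d = # 4
v₁ e = # 5
v₁ f = # 6
v₁ g = # 7
v₁ h = # 8
v₂ x = # 9
v₂ a = # 10
v₂ b = # 11
v₂ c = # 12
v₂ d = # 13
v₂ e = # 14
v₂ f = # 15
v₂ g = # 16
v₂ h = # 17

copyEdges : (Letter → V18) → List (V18 × V18)
copyEdges v =
  (v x , v a) ∷ (v x , v b) ∷ (v a , v c) ∷ (v b , v d) ∷ (v c , v d) ∷
  (v c , v e) ∷ (v d , v f) ∷ (v e , v g) ∷ (v e , v h) ∷ (v f , v g) ∷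
  (v f , v h) ∷ []

edges18 : List (V18 × V18)
edges18 = copyEdges v₁ ++ copyEdges v₂ ++ ((v₁ x , v₂ x) ∷ [])

Adj18 : V18 → V18 → Set
Adj18 u v = ((u , v) ∈ edges18) ⊎ ((v , u) ∈ edges18)

adj18? : ∀ u v → Dec (Adj18 u v)
adj18? u v = mem? dec (u , v) edges18 ⊎-dec mem? dec (v , u) edges18
  where
    dec = ≡-dec _≟ᶠ_ _≟ᶠ_

{-# OPTIONS --safe #-}
-- No K₄ minor: G₁₈ is a subgraph of a 2-tree, in which each vertex is attached to two adjacent
-- (or equal) earlier ones.  Deleting the last vertex z of a 2-tree from the branch sets keeps them
-- a K₄ minor: its remaining neighbours form a clique, so walks through z can be shortcut, and a
-- branch set {z} would have to touch three disjoint sets using only two neighbours.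
--
-- No crumby colouring: inside each copy, c and d cannot both be red, since one of e, f is red, say e,
-- and then f and its neighbours g, h are blue.  A blue x would force c and d red; blue a and b lead to
-- exactly one of c, d being red and then to a red path c e g f or c e h f (up to reflection).  So x
-- is red with a red neighbour in its copy, and the two copies give a red path through the edge x₁x₂.
module Submission where

open import Defs
open import Data.Bool using (Bool; true; false)
open import Data.Bool.Properties using (¬-not)
open import Data.Empty using (⊥; ⊥-elim)
open import Data.Fin using (Fin; zero; suc; toℕ; fromℕ<; punchIn; _≤_; _<_)
open import Data.Fin.Induction using (<-wellFounded)
open import Data.Fin.Properties
  using (_≟_; _≤?_; _<?_; all?; any?; sequence; toℕ-fromℕ<;
         toℕ-injective; toℕ<n; punchIn-injective; punchInᵢ≢i)
open import Data.List using (List; []; _∷_; map)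
open import Data.List.Membership.DecPropositional (_≟_ {18}) using (_∈?_)
open import Data.List.Relation.Unary.Any using (Any; here; there)
import Data.List.Relation.Unary.Any as Any
open import Data.List.Relation.Unary.Any.Properties using (map⁻)
open import Data.Nat as ℕ using (ℕ; zero; suc)
import Data.Nat.Properties as ℕ
open import Data.Product using (∃; _×_; _,_; proj₁; proj₂)
open import Data.Sum using (_⊎_; inj₁; inj₂; swap)
open import Data.Unit using (⊤; tt)
open import Data.Vec using (Vec; []; _∷_; _++_; lookup)
open import Effect.Monad using (RawMonad)
open import Function using (_∘_)
open import Induction.WellFounded using (Acc; acc)
open import Relation.Binary.PropositionalEquality using (_≡_; _≢_; refl; sym; trans)
open import Relation.Nullary using (¬_; Dec; yes; no; ¬?; contradiction)
open import Relation.Nullary.Decidable using (True; toWitness; from-yes; _×-dec_; _⊎-dec_; _→-dec_)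
open import Relation.Nullary.Negation using (¬¬-Monad)

-- Walks and connectedness.

module _ {V : Set} {E : V → V → Set} {S : V → Set} where

  _++ʷ_ : ∀ {u v w} → WalkIn E S u v → WalkIn E S v w → WalkIn E S u w
  here _     ++ʷ q = q
  step s uv p ++ʷ q = step s uv (p ++ʷ q)

  walk-start : ∀ {u v} → WalkIn E S u v → S u
  walk-start (here s)     = s
  walk-start (step s _ _) = s

  reverseʷ : (∀ {u v} → E u v → E v u) → ∀ {u v} → WalkIn E S u v → WalkIn E S v u
  reverseʷ E-sym (here s)     = here s
  reverseʷ E-sym (step s uv p) =
    reverseʷ E-sym p ++ʷ step (walk-start p) (E-sym uv) (here s)

  mapʷ : ∀ {F : V → V → Set} → (∀ {u v} → E u v → F u v) →
         ∀ {u v} → WalkIn E S u v → WalkIn F S u v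
  mapʷ E⊆F (here s)     = here s
  mapʷ E⊆F (step s uv p) = step s (E⊆F uv) (mapʷ E⊆F p)

connected-by-descent : ∀ {n} {E : Fin (suc n) → Fin (suc n) → Set} → (∀ {u v} → E u v → E v u) →
                       (∀ i → ∃ λ j → j < suc i × E (suc i) j) → Connected E
connected-by-descent {n} {E} E-sym lower u v = to-root u ++ʷ reverseʷ E-sym (to-root v)
  where
  go : ∀ w → Acc _<_ w → WalkIn E (λ _ → ⊤) w zero
  go zero    _         = here tt
  go (suc i) (acc rec) = let j , j<i , uv = lower i in step tt uv (go j (rec j<i))

  to-root : ∀ w → WalkIn E (λ _ → ⊤) w zero
  to-root w = go w (<-wellFounded w)

-- Minors of 2-trees.

module TwoTree {n} (parents : Fin n → Fin n × Fin n) where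

  p q : Fin n → Fin n
  p = proj₁ ∘ parents
  q = proj₂ ∘ parents

  Child : Fin n → Fin n → Set
  Child u v = v ≡ p u ⊎ v ≡ q u

  -- Reflexivity covers coinciding parents, and lets a shortcut join two neighbours of `z` that turn
  -- out to be equal.
  Near : Fin n → Fin n → Set
  Near u v = u ≡ v ⊎ Child u v ⊎ Child v u

  near? : ∀ u v → Dec (Near u v)
  near? u v = u ≟ v ⊎-dec (child? u v ⊎-dec child? v u)
    where
    child? : ∀ u v → Dec (Child u v)
    child? u v = v ≟ p u ⊎-dec v ≟ q u

  near-sym : ∀ {u v} → Near u v → Near v u
  near-sym (inj₁ u≡v) = inj₁ (sym u≡v)
  near-sym (inj₂ s)   = inj₂ (swap s)

  module _ (p≤ : ∀ u → p u ≤ u) (q≤ : ∀ u → q u ≤ u) (p~q : ∀ u → Near (p u) (q u)) where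

    child-≤ : ∀ {u v} → Child u v → v ≤ u
    child-≤ {u} (inj₁ refl) = p≤ u
    child-≤ {u} (inj₂ refl) = q≤ u

    earlier-near : ∀ {z u} → u ≤ z → u ≢ z → Near z u → Child z u
    earlier-near u≤z u≢z (inj₁ z≡u)        = contradiction (sym z≡u) u≢z
    earlier-near u≤z u≢z (inj₂ (inj₁ zu))  = zu
    earlier-near u≤z u≢z (inj₂ (inj₂ uz))  =
      contradiction (toℕ-injective (ℕ.≤-antisym u≤z (child-≤ uz))) u≢z

    children-near : ∀ {z u w} → Child z u → Child z w → Near u w
    children-near (inj₁ refl) (inj₁ refl) = inj₁ refl
    children-near (inj₁ refl) (inj₂ refl) = p~q _
    children-near (inj₂ refl) (inj₁ refl) = near-sym (p~q _)
    children-near (inj₂ refl) (inj₂ refl) = inj₁ refl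

    module Delete (z : Fin n) where

      _∖z : (Fin n → Set) → Fin n → Set
      (S ∖z) v = S v × v ≢ z

      module _ {S : Fin n → Set} (S≤z : ∀ {v} → S v → v ≤ z) where

        child : ∀ {v} → (S ∖z) v → Near z v → Child z v
        child (s , v≢z) = earlier-near (S≤z s) v≢z

        exit : ∀ {w} → w ≢ z → WalkIn Near S z w → ∃ λ v → (S ∖z) v × Child z v
        exit w≢z (here _) = contradiction refl w≢z
        exit w≢z (step {v = v} _ uv r) with v ≟ z
        -- `Near` is reflexive, so the walk may linger at `z`.
        ... | yes refl = exit w≢z r
        ... | no  v≢z  = let m = walk-start r , v≢z in v , m , child m uv

        -- `bypass` remembers `u`, the last vertex before the walk entered `z`. On leaving `z`, the
        -- next vertex is, like `u`, a parent of `z`, so a single step joins them.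
        shortcut : ∀ {u w} → u ≢ z → w ≢ z → WalkIn Near S u w → WalkIn Near (S ∖z) u w
        bypass   : ∀ {u w} → (S ∖z) u → Child z u → w ≢ z → WalkIn Near S z w → WalkIn Near (S ∖z) u w

        shortcut u≢z w≢z (here s) = here (s , u≢z)
        shortcut u≢z w≢z (step {v = v} s uv r) with v ≟ z
        ... | yes refl = bypass (s , u≢z) (child (s , u≢z) (near-sym uv)) w≢z r
        ... | no  v≢z  = step (s , u≢z) uv (shortcut v≢z w≢z r)

        bypass m zu w≢z (here _) = contradiction refl w≢z
        bypass m zu w≢z (step {v = v} _ uv r) with v ≟ z
        ... | yes refl = bypass m zu w≢z r
        ... | no  v≢z  =
          step m (children-near zu (child (walk-start r , v≢z) uv)) (shortcut v≢z w≢z r)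

    -- `HasK4Minor Near` with the branch sets exposed, so that the induction can shrink them and
    -- bound their vertices.
    IsK4Minor : (Fin 4 → Fin n → Set) → Set
    IsK4Minor B =
      (∀ i → ∃ λ v → B i v) ×
      (∀ i j v → i ≢ j → B i v → B j v → ⊥) ×
      (∀ i → ConnectedIn Near (B i)) ×
      (∀ i j → i ≢ j → ∃ λ u → ∃ λ v → B i u × B j v × Near u v)

    module _ {B : Fin 4 → Fin n → Set} (minor : IsK4Minor B)
             (z : Fin n) (B≤z : ∀ {i v} → B i v → v ≤ z) where

      open Delete z

      private
        disjoint  = proj₁ (proj₂ minor)
        connected = proj₁ (proj₂ (proj₂ minor))
        touching  = proj₂ (proj₂ (proj₂ minor))

      -- Pigeonhole on `p z` and `q z`: two of the three disjoint sets would share one of them.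
      not-all-meet-parents : ∀ (σ : Fin 3 → Fin 4) → (∀ {k l} → k ≢ l → σ k ≢ σ l) →
                             ¬ (∀ k → B (σ k) (p z) ⊎ B (σ k) (q z))
      not-all-meet-parents σ σ-inj meets = go (meets zero) (meets (suc zero)) (meets (suc (suc zero)))
        where
        apart : ∀ k l {v} → k ≢ l → B (σ k) v → B (σ l) v → ⊥
        apart k l k≢l = disjoint (σ k) (σ l) _ (σ-inj k≢l)

        Meets : Fin 3 → Set
        Meets k = B (σ k) (p z) ⊎ B (σ k) (q z)

        go : Meets zero → Meets (suc zero) → Meets (suc (suc zero)) → ⊥
        go (inj₁ s) (inj₁ t) _        = apart _ _ (λ ()) s t
        go (inj₂ s) (inj₂ t) _        = apart _ _ (λ ()) s t
        go (inj₁ s) (inj₂ _) (inj₁ t) = apart _ _ (λ ()) s t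
        go (inj₁ _) (inj₂ s) (inj₂ t) = apart _ _ (λ ()) s t
        go (inj₂ _) (inj₁ s) (inj₁ t) = apart _ _ (λ ()) s t
        go (inj₂ s) (inj₁ _) (inj₂ t) = apart _ _ (λ ()) s t

      -- Otherwise the edges from `B i` to the other three sets would all start at `z` and end at
      -- its parents. Branch sets are arbitrary predicates, so a vertex other than `z` cannot be
      -- found by search; hence the double negation.
      delete-nonempty : ∀ i → ¬ ¬ ∃ (B i ∖z)
      delete-nonempty i empty =
        not-all-meet-parents (punchIn i) (λ k≢l → k≢l ∘ punchIn-injective i _ _) meets
        where
        meets : ∀ k → B (punchIn i k) (p z) ⊎ B (punchIn i k) (q z)
        meets k with touching i (punchIn i k) (punchInᵢ≢i i k ∘ sym)
        ... | u , v , Bu , Bv , uv with u ≟ z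
        ...   | no  u≢z  = contradiction (u , Bu , u≢z) empty
        ...   | yes refl with earlier-near (B≤z Bv) v≢z uv
          where
          v≢z : v ≢ z
          v≢z refl = disjoint i (punchIn i k) z (punchInᵢ≢i i k ∘ sym) Bu Bv
        ...     | inj₁ refl = inj₁ Bv
        ...     | inj₂ refl = inj₂ Bv

      delete-minor : (∀ i → ∃ (B i ∖z)) → IsK4Minor (λ i → B i ∖z)
      delete-minor nonempty =
        nonempty ,
        (λ i j v i≢j s t → disjoint i j v i≢j (proj₁ s) (proj₁ t)) ,
        (λ i u v (Bu , u≢z) (Bv , v≢z) → shortcut B≤z u≢z v≢z (connected i u v Bu Bv)) ,
        touching′
        where
        leave : ∀ i → B i z → ∃ λ v → (B i ∖z) v × Child z v
        leave i Bz = let w , Bw , w≢z = nonempty i in exit B≤z w≢z (connected i z w Bz Bw)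

        touching′ : ∀ i j → i ≢ j → ∃ λ u → ∃ λ v → (B i ∖z) u × (B j ∖z) v × Near u v
        touching′ i j i≢j with touching i j i≢j
        ... | u , v , Bu , Bv , uv with u ≟ z | v ≟ z
        ... | yes refl | yes refl = ⊥-elim (disjoint i j z i≢j Bu Bv)
        ... | no  u≢z  | no  v≢z  = u , v , (Bu , u≢z) , (Bv , v≢z) , uv
        -- `z` is replaced by a vertex `w` at which a walk in its branch set leaves it; `w` and `v`
        -- are both parents of `z`, hence near.
        ... | yes refl | no  v≢z  =
          let w , Bw , zw = leave i Bu in
          w , v , Bw , (Bv , v≢z) , children-near zw (child B≤z (Bv , v≢z) uv)
        ... | no  u≢z  | yes refl =
          let w , Bw , zw = leave j Bv in
          u , w , (Bu , u≢z) , Bw , children-near (child B≤z (Bu , u≢z) (near-sym uv)) zw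

    -- Induction on a bound for the vertices in use: deleting `z`, the vertex numbered `k`, lowers
    -- it by one.
    no-minor-below : ∀ k → k ℕ.≤ n → ∀ {B} → IsK4Minor B → (∀ {i v} → B i v → toℕ v ℕ.< k) → ⊥
    no-minor-below zero    _   (nonempty , _) B<k with B<k (proj₂ (nonempty zero))
    ... | ()
    no-minor-below (suc k) k<n {B} minor B<k =
      -- `sequence` pulls the double negation out of the quantifier over the four sets; since the
      -- goal is `⊥`, the witnesses may then be used.
      sequence (RawMonad.rawApplicative ¬¬-Monad) (delete-nonempty minor z B≤z) λ nonempty →
        no-minor-below k (ℕ.<⇒≤ k<n) (delete-minor minor z B≤z nonempty) B∖z<k
      where
      z : Fin n
      z = fromℕ< k<n

      z≡k : toℕ z ≡ k
      z≡k = toℕ-fromℕ< k<n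

      B≤z : ∀ {i v} → B i v → v ≤ z
      B≤z s = ℕ.≤-trans (ℕ.s≤s⁻¹ (B<k s)) (ℕ.≤-reflexive (sym z≡k))

      B∖z<k : ∀ {i v} → B i v × v ≢ z → toℕ v ℕ.< k
      B∖z<k (s , v≢z) =
        ℕ.≤∧≢⇒< (ℕ.s≤s⁻¹ (B<k s)) λ v≡k → v≢z (toℕ-injective (trans v≡k (sym z≡k)))

    subgraph-no-K4-minor : ∀ {E : Fin n → Fin n → Set} → (∀ {u v} → E u v → Near u v) → ¬ HasK4Minor E
    subgraph-no-K4-minor E⊆Near (B , nonempty , disjoint , connected , touching) =
      no-minor-below n ℕ.≤-refl minor (λ {_} {v} _ → toℕ<n v)
      where
      minor : IsK4Minor B
      minor =
        nonempty , disjoint ,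
        (λ i u v s t → mapʷ E⊆Near (connected i u v s t)) ,
        (λ i j i≢j → let u , v , s , t , uv = touching i j i≢j in u , v , s , t , E⊆Near uv)

-- A 2-tree containing the graph.

copyParents : (Letter → V18) → Vec (V18 × V18) 9
copyParents v =
  -- The first entry makes `v₁ x` its own parent in the first copy and yields the bridge in the
  -- second. The added edges `ab`, `bc`, `de`, `ef` triangulate the two five-cycles through `cd`.
  (v₁ x , v₁ x) ∷ (v x , v x) ∷ (v x , v a) ∷ (v a , v b) ∷ (v b , v c) ∷
  (v c , v d) ∷ (v d , v e) ∷ (v e , v f) ∷ (v e , v f) ∷ []

open TwoTree (lookup (copyParents v₁ ++ copyParents v₂))

no-K4-minor : ¬ HasK4Minor Adj18
no-K4-minor = subgraph-no-K4-minor
  (from-yes (all? λ u → p u ≤? u))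
  (from-yes (all? λ u → q u ≤? u))
  (from-yes (all? λ u → near? (p u) (q u)))
  (λ {u} {v} → from-yes (all? λ u → all? λ v → adj18? u v →-dec near? u v) u v)

-- Crumby colourings.

IsP4 : V18 → V18 → V18 → V18 → Set
IsP4 s t u v =
  (s ≢ t × s ≢ u × s ≢ v × t ≢ u × t ≢ v × u ≢ v) × (Adj18 s t × Adj18 t u × Adj18 u v)

isP4? : ∀ s t u v → Dec (IsP4 s t u v)
isP4? s t u v =
  (s ≠ t ×-dec s ≠ u ×-dec s ≠ v ×-dec t ≠ u ×-dec t ≠ v ×-dec u ≠ v) ×-dec
  (adj18? s t ×-dec adj18? t u ×-dec adj18? u v)
  where
  _≠_ : ∀ (u v : V18) → Dec (u ≢ v)
  u ≠ v = ¬? (u ≟ v)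

copy : Fin 2 → Letter → V18
copy zero       = v₁
copy (suc zero) = v₂

mirror : Letter → Letter
mirror x = x
mirror a = b
mirror b = a
mirror c = d
mirror d = c
mirror e = f
mirror f = e
mirror g = g
mirror h = h

-- The second index selects the identity or the reflection of the copy.
η : Fin 2 → Fin 2 → Letter → V18
η k zero       l = copy k l
η k (suc zero) l = copy k (mirror l)

module _ (col : V18 → Bool) (crumby : IsCrumby Adj18 col) where

  private
    Redᶜ Blueᶜ : V18 → Set
    Redᶜ  = Red  Adj18 col
    Blueᶜ = Blue Adj18 col

  red-or-blue : ∀ v → Redᶜ v ⊎ Blueᶜ v
  red-or-blue v with col v
  ... | true  = inj₁ refl
  ... | false = inj₂ refl

  clash : ∀ {v} {A : Set} → Redᶜ v → Blueᶜ v → A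
  clash r s with trans (sym r) s
  ... | ()

  red-P4-free : ∀ {s t u v} → IsP4 s t u v → Redᶜ s → Redᶜ t → Redᶜ u → Redᶜ v → ⊥
  red-P4-free ((s≢t , s≢u , s≢v , t≢u , t≢v , u≢v) , st , tu , uv) rs rt ru rv =
    proj₂ (proj₂ crumby) _ _ _ _ rs rt ru rv s≢t s≢u s≢v t≢u t≢v u≢v st tu uv

  -- Here `k` and `m` are variables, so the adjacency facts are decided for all their values at
  -- once: such a check is closed and evaluates.
  module Oriented (k m : Fin 2) where

    R B : Letter → Set
    R l = Redᶜ  (η k m l)
    B l = Blueᶜ (η k m l)

    colour : ∀ l → R l ⊎ B l
    colour l = red-or-blue (η k m l)

    -- Transparent, these would make the with-abstractions below normalise the decision procedures.
    opaque

      star : ∀ l₁ l₂ l₃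
             {_ : True (all? λ k → all? λ m →
                    adj18? (η k m l₁) (η k m l₂) ×-dec adj18? (η k m l₁) (η k m l₃) ×-dec
                    ¬? (η k m l₂ ≟ η k m l₃))} →
             B l₁ → B l₂ → B l₃ → ⊥
      star _ _ _ {t} b₁ b₂ b₃ =
        let e₂ , e₃ , l₂≢l₃ = toWitness t k m in l₂≢l₃ (proj₁ crumby _ _ _ b₁ b₂ b₃ e₂ e₃)

      path : ∀ l₁ l₂ l₃ l₄
             {_ : True (all? λ k → all? λ m → isP4? (η k m l₁) (η k m l₂) (η k m l₃) (η k m l₄))} →
             R l₁ → R l₂ → R l₃ → R l₄ → ⊥
      path _ _ _ _ {t} = red-P4-free (toWitness t k m)

      red-neighbour : ∀ l ls
                      {_ : True (all? λ k → all? λ m → all? λ u →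
                             adj18? (η k m l) u →-dec u ∈? map (η k m) ls)} →
                      R l → Any R ls
      red-neighbour l ls {t} r =
        let u , lu , ru = proj₁ (proj₂ crumby) _ r in
        map⁻ {P = Redᶜ} (Any.map (λ { refl → ru }) (toWitness t k m u lu))

    -- Next to a blue `e`, one of `g` and `h` is red, and it would have only the blue neighbours `e`
    -- and `f`.
    ef-not-blue : B e → B f → ⊥
    ef-not-blue eB fB with colour g | colour h
    ... | inj₂ gB | inj₂ hB   = star e g h eB gB hB
    ... | inj₁ gR | _         with red-neighbour g (e ∷ f ∷ []) gR
    ...   | here eR           = clash eR eB
    ...   | there (here fR)   = clash fR fB
    ef-not-blue eB fB | inj₂ _ | inj₁ hR with red-neighbour h (e ∷ f ∷ []) hR
    ...   | here eR           = clash eR eB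
    ...   | there (here fR)   = clash fR fB

    cde-not-red : R c → R d → R e → ⊥
    cde-not-red cR dR eR with colour f | colour g | colour h
    ... | inj₁ fR | _       | _       = path e c d f eR cR dR fR
    ... | inj₂ fB | inj₁ gR | _       = path d c e g dR cR eR gR
    ... | inj₂ fB | inj₂ gB | inj₁ hR = path d c e h dR cR eR hR
    ... | inj₂ fB | inj₂ gB | inj₂ hB = star f g h fB gB hB

    -- A blue `a` already has `x` as its blue neighbour; a red `a` needs `c` as its red neighbour.
    x-blue⇒c-red : B x → R c
    x-blue⇒c-red xB with colour a
    ... | inj₂ aB = ¬-not (star a x c aB xB)
    ... | inj₁ aR with red-neighbour a (x ∷ c ∷ []) aR
    ...   | here xR         = clash xR xB
    ...   | there (here cR) = cR

    -- Blue `b` and `d` force `f` red, and only `e` can be a red neighbour of `c`. The red neighbour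
    -- of `f` is `g` or `h`, which completes a red path from `c` through `e` to `f`.
    ab-blue⇒not-only-c-red : B a → B b → R c → B d → ⊥
    ab-blue⇒not-only-c-red aB bB cR dB
      with ¬-not (star d b f dB bB) | red-neighbour c (a ∷ d ∷ e ∷ []) cR
    ... | fR | here aR                 = clash aR aB
    ... | fR | there (here dR)         = clash dR dB
    ... | fR | there (there (here eR)) with red-neighbour f (d ∷ g ∷ h ∷ []) fR
    ...   | here dR                    = clash dR dB
    ...   | there (here gR)            = path c e g f cR eR gR fR
    ...   | there (there (here hR))    = path c e h f cR eR hR fR

    acd-not-blue : B a → B c → B d → ⊥
    acd-not-blue aB cB dB = star c a d cB aB dB

  module _ (k : Fin 2) where

    private
      module I = Oriented k zero
      module M = Oriented k (suc zero)

    cd-not-red : I.R c → I.R d → ⊥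
    cd-not-red cR dR =
      -- `M` swaps `c` with `d` and `e` with `f` definitionally, so the same lemma excludes a red
      -- `f`.
      I.ef-not-blue (¬-not (I.cde-not-red cR dR)) (¬-not (M.cde-not-red dR cR))

    x-red : I.R x
    x-red = ¬-not λ xB → cd-not-red (I.x-blue⇒c-red xB) (M.x-blue⇒c-red xB)

    ab-not-blue : I.B a → I.B b → ⊥
    ab-not-blue aB bB with I.colour c | I.colour d
    ... | inj₁ cR | inj₁ dR = cd-not-red cR dR
    ... | inj₁ cR | inj₂ dB = I.ab-blue⇒not-only-c-red aB bB cR dB
    ... | inj₂ cB | inj₁ dR = M.ab-blue⇒not-only-c-red bB aB dR cB
    ... | inj₂ cB | inj₂ dB = I.acd-not-blue aB cB dB

    -- A red `b` is reported as the red `a` of the mirrored copy.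
    a-or-b-red : ∃ λ m → Oriented.R k m a
    a-or-b-red with I.colour a
    ... | inj₁ aR = zero , aR
    ... | inj₂ aB = suc zero , ¬-not (ab-not-blue aB)

  not-crumby : ⊥
  not-crumby =
    let m₁ , r₁ = a-or-b-red zero
        m₂ , r₂ = a-or-b-red (suc zero)
    in red-P4-free
         (from-yes (all? λ m₁ → all? λ m₂ →
            isP4? (η zero m₁ a) (v₁ x) (v₂ x) (η (suc zero) m₂ a)) m₁ m₂)
         r₁ (x-red zero) (x-red (suc zero)) r₂

theorem2 : Connected Adj18 × Subcubic adj18? × ¬ HasK4Minor Adj18 × ¬ HasCrumbyColouring Adj18
theorem2 =
  connected-by-descent swap (from-yes (all? λ i → any? λ j → j <? suc i ×-dec adj18? (suc i) j)) ,
  from-yes (all? λ u → degree adj18? u ℕ.≤? 3) ,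
  no-K4-minor ,
  λ (col , crumby) → not-crumby col crumby
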